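{- For every positive integer $n$, $\mathrm{ex}(n,C_3,\mathrm{rainbow}\text{ - }C_5)\leq 32n^{3/2}$; that is, every $n$-vertex graph that admits a proper edge-coloring with no rainbow copy of the $5$-cycle $C_5$ contains at most $32n^{3/2}$ triangles.
   Context: $C_m$ denotes the cycle with $m$ edges; $C_3$ is a triangle. A proper edge-coloring assigns colors to edges so that edges sharing a vertex get distinct colors. A copy of a graph in an edge-colored graph is rainbow if all its edges receive distinct colors. For graphs $F,H$, $\mathrm{ex}(n,F,\mathrm{rainbow}\text{ - }H)$ is the maximum number of copies of $F$ in an $n$-vertex graph that has a proper edge-coloring containing no rainbow copy of $H$. -}

module Defs where

open import Data.Nat using (ℕ; _<_; _<?_)
open import Data.Bool using (Bool; true; false; T)
open import Data.Fin using (Fin; toℕ)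
open import Data.List using (List; []; _∷_; length; filter; concatMap; allFin)
open import Data.Product using (_×_; _,_; Σ)
open import Relation.Binary.PropositionalEquality using (_≡_; _≢_)
open import Relation.Nullary using (¬_; Dec)
open import Relation.Nullary.Decidable using (_×-dec_)

record Graph (n : ℕ) : Set where
  field
    adj     : Fin n → Fin n → Bool
    symm    : ∀ u v → adj u v ≡ adj v u
    irrefl  : ∀ u → adj u u ≡ false

open Graph public

Adj : ∀ {n} → Graph n → Fin n → Fin n → Set
Adj G u v = T (adj G u v)

record ProperEdgeColoring {n : ℕ} (G : Graph n) : Set where
  field
    col    : Fin n → Fin n → ℕ
    col-sym : ∀ u v → Adj G u v → col u v ≡ col v u
    proper : ∀ u v w → Adj G u v → Adj G u w → v ≢ w → col u v ≢ col u w

open ProperEdgeColoring public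

record RainbowC5 {n : ℕ} (G : Graph n) (c : ProperEdgeColoring G) : Set where
  field
    v0 v1 v2 v3 v4 : Fin n
    d01 : v0 ≢ v1
    d02 : v0 ≢ v2
    d03 : v0 ≢ v3
    d04 : v0 ≢ v4
    d12 : v1 ≢ v2
    d13 : v1 ≢ v3
    d14 : v1 ≢ v4
    d23 : v2 ≢ v3
    d24 : v2 ≢ v4
    d34 : v3 ≢ v4
    e01 : Adj G v0 v1
    e12 : Adj G v1 v2
    e23 : Adj G v2 v3
    e34 : Adj G v3 v4
    e40 : Adj G v4 v0
    c-a-b : col c v0 v1 ≢ col c v1 v2
    c-a-c : col c v0 v1 ≢ col c v2 v3
    c-a-d : col c v0 v1 ≢ col c v3 v4
    c-a-e : col c v0 v1 ≢ col c v4 v0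
    c-b-c : col c v1 v2 ≢ col c v2 v3
    c-b-d : col c v1 v2 ≢ col c v3 v4
    c-b-e : col c v1 v2 ≢ col c v4 v0
    c-c-d : col c v2 v3 ≢ col c v3 v4
    c-c-e : col c v2 v3 ≢ col c v4 v0
    c-d-e : col c v3 v4 ≢ col c v4 v0

triples : (n : ℕ) → List (Fin n × Fin n × Fin n)
triples n = concatMap (λ a → concatMap (λ b → Data.List.map (λ c → a , b , c) (allFin n)) (allFin n)) (allFin n)

IsTriangle : ∀ {n} → Graph n → Fin n × Fin n × Fin n → Set
IsTriangle G (a , b , c) =
  (toℕ a < toℕ b) × (toℕ b < toℕ c) × Adj G a b × Adj G b c × Adj G a c

isTriangle? : ∀ {n} (G : Graph n) (t : Fin n × Fin n × Fin n) → Dec (IsTriangle G t)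
isTriangle? G (a , b , c) =
  (toℕ a <? toℕ b) ×-dec (toℕ b <? toℕ c) ×-dec
  Data.Bool.T? (adj G a b) ×-dec Data.Bool.T? (adj G b c) ×-dec Data.Bool.T? (adj G a c)

triangleCount : ∀ {n} → Graph n → ℕ
triangleCount {n} G = length (filter (isTriangle? G) (triples n))

{-# OPTIONS --safe #-}

-- Call a pair of vertices few if it has at most 6 common neighbours.  Choosing
-- the vertices of a 5-cycle one at a time, so that each new one avoids
-- boundedly many vertices and colours, shows in the absence of a rainbow C₅:
--
--  * if v x y is a triangle then vx or vy is few (else extend to v w x y z);
--  * if ux lies in a triangle uxe then v = u, v = e or col xv = col ue for
--    every neighbour v of x such that uv is not few (else extend to u e x v y),
--    so there are at most 3 such v.
--
-- Let d(x) be the degree of x in the graph of the edges lying in triangles, and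
-- M = Σ d(x).  The second fact gives Σ d(x)² ≤ 6n² + 3M ≤ 9n², so M² ≤ 9n³ by
-- Cauchy–Schwarz.  The first gives at most 6M triangles.
module Submission where

open import Defs
open import Data.Bool using (T; T?; if_then_else_)
open import Data.Empty using (⊥)
open import Data.Fin using (Fin; zero; suc; toℕ)
open import Data.Fin.Properties using (any?; toℕ-injective) renaming (_≟_ to _≟ᶠ_)
open import Data.List using (List; []; _∷_; length; filter; concatMap; tabulate; map; allFin; _++_)
open import Data.List.Properties using (filter-++; length-++)
open import Data.List.Relation.Unary.All as All using (All; []; _∷_)
open import Data.Nat using (ℕ; zero; suc; _+_; _*_; _^_; _≤_; _<_; z≤n; s≤s; _≤?_; _<?_; _≟_)
open import Data.Nat.Properties
open import Data.Nat.Tactic.RingSolver using (solve-∀)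
open import Data.Product using (_×_; _,_; ∃; proj₁; proj₂)
open import Data.Sum using (_⊎_; inj₁; inj₂; [_,_]′)
open import Function using (_∘_; id; case_of_)
open import Relation.Binary.PropositionalEquality using (_≡_; _≢_; refl; sym; trans; cong; cong₂; subst; ≢-sym; module ≡-Reasoning)
open import Relation.Nullary using (¬_; Dec; yes; no; does; contradiction)
open import Relation.Nullary.Decidable using (_×-dec_; ¬?; decidable-stable)
open import Relation.Unary using (Pred; Decidable)
open import Level using (0ℓ)

open import Algebra.Properties.Semiring.Sum +-*-semiring
  using (sum; sum-cong-≗; ∑-distrib-+; ∑-comm; *-distribˡ-sum; *-distribʳ-sum; sum-syntax)

private variable
  n : ℕ
  P Q R : Set

-- Sums of natural numbers

∑-mono : {f g : Fin n → ℕ} → (∀ i → f i ≤ g i) → ∑[ i < n ] f i ≤ ∑[ i < n ] g i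
∑-mono {zero}  _   = z≤n
∑-mono {suc _} f≤g = +-mono-≤ (f≤g zero) (∑-mono (f≤g ∘ suc))

∑-const : ∀ n k → ∑[ i < n ] k ≡ n * k
∑-const zero    k = refl
∑-const (suc n) k = cong (k +_) (∑-const n k)

∑-bounded : ∀ {k} {f : Fin n → ℕ} → (∀ i → f i ≤ k) → ∑[ i < n ] f i ≤ n * k
∑-bounded {n} f≤k = ≤-trans (∑-mono f≤k) (≤-reflexive (∑-const n _))

∑-*-∑ : (f g : Fin n → ℕ) →
        (∑[ i < n ] f i) * (∑[ j < n ] g j) ≡ ∑[ i < n ] ∑[ j < n ] (f i * g j)
∑-*-∑ f g = trans (*-distribʳ-sum (sum g) f) (sum-cong-≗ λ i → *-distribˡ-sum (f i) g)

2mn≤m²+n² : ∀ m n → 2 * (m * n) ≤ m * m + n * n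
2mn≤m²+n² m n = [ ordered , flipped ]′ (≤-total m n)
  where
  ordered : ∀ {m n} → m ≤ n → 2 * (m * n) ≤ m * m + n * n
  -- Writing the larger number as `m + k` makes the difference of the two sides `k * k`.
  ordered {m} m≤n with k , refl ← m≤n⇒∃[o]m+o≡n m≤n =
    subst (2 * (m * (m + k)) ≤_) (expand m k) (m≤m+n _ (k * k))
    where
    expand : ∀ m k → 2 * (m * (m + k)) + k * k ≡ m * m + (m + k) * (m + k)
    expand = solve-∀
  flipped : n ≤ m → 2 * (m * n) ≤ m * m + n * n
  flipped n≤m = subst (_≤ m * m + n * n) (cong (2 *_) (*-comm n m))
    (subst (2 * (n * m) ≤_) (+-comm (n * n) (m * m)) (ordered n≤m))

-- The square expands into the sum of `f i * f j` over all ordered pairs, and twice each term is at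
-- most `f i * f i + f j * f j`. Proving the doubled inequality and cancelling 2 avoids division.
cauchy-schwarz : (f : Fin n → ℕ) →
                 (∑[ i < n ] f i) * (∑[ i < n ] f i) ≤ n * ∑[ i < n ] (f i * f i)
cauchy-schwarz {n} f = *-cancelˡ-≤ 2 (begin
  2 * (sum f * sum f)
    ≡⟨ cong (2 *_) (∑-*-∑ f f) ⟩
  2 * (∑[ i < n ] ∑[ j < n ] (f i * f j))
    ≡⟨ *-distribˡ-sum 2 (λ i → ∑[ j < n ] (f i * f j)) ⟩
  ∑[ i < n ] (2 * ∑[ j < n ] (f i * f j))
    ≡⟨ sum-cong-≗ (λ i → *-distribˡ-sum 2 (λ j → f i * f j)) ⟩
  ∑[ i < n ] ∑[ j < n ] (2 * (f i * f j))
    ≤⟨ ∑-mono (λ i → ∑-mono λ j → 2mn≤m²+n² (f i) (f j)) ⟩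
  ∑[ i < n ] ∑[ j < n ] (f i * f i + f j * f j)
    ≡⟨ sum-cong-≗ (λ i → trans (∑-distrib-+ (λ _ → f i * f i) (λ j → f j * f j))
                               (cong (_+ S) (∑-const n (f i * f i)))) ⟩
  ∑[ i < n ] (n * (f i * f i) + S)
    ≡⟨ ∑-distrib-+ (λ i → n * (f i * f i)) (λ _ → S) ⟩
  (∑[ i < n ] (n * (f i * f i))) + ∑[ i < n ] S
    ≡⟨ cong₂ _+_ (sym (*-distribˡ-sum n (λ i → f i * f i))) (∑-const n S) ⟩
  n * S + n * S
    ≡⟨ cong (n * S +_) (sym (+-identityʳ (n * S))) ⟩
  2 * (n * S) ∎)
  where
  open ≤-Reasoning
  S = ∑[ i < n ] (f i * f i)

-- Indicators and counting

𝟙 : Dec P → ℕ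
𝟙 P? = if does P? then 1 else 0

𝟙≤1 : (P? : Dec P) → 𝟙 P? ≤ 1
𝟙≤1 (yes _) = ≤-refl
𝟙≤1 (no _)  = z≤n

𝟙-mono : (P? : Dec P) (Q? : Dec Q) → (P → Q) → 𝟙 P? ≤ 𝟙 Q?
𝟙-mono (no _)  _       _   = z≤n
𝟙-mono (yes _) (yes _) _   = ≤-refl
𝟙-mono (yes p) (no ¬q) p⇒q = contradiction (p⇒q p) ¬q

𝟙-cover : (P? : Dec P) (Q? : Dec Q) (R? : Dec R) → (P → Q ⊎ R) → 𝟙 P? ≤ 𝟙 Q? + 𝟙 R?
𝟙-cover (no _)  _  _  _ = z≤n
𝟙-cover (yes p) Q? R? p⇒q⊎r with p⇒q⊎r p
... | inj₁ q = ≤-trans (𝟙-mono (yes p) Q? λ _ → q) (m≤m+n _ _)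
... | inj₂ r = ≤-trans (𝟙-mono (yes p) R? λ _ → r) (m≤n+m _ _)

𝟙-× : (P? : Dec P) (Q? : Dec Q) → 𝟙 (P? ×-dec Q?) ≡ 𝟙 P? * 𝟙 Q?
𝟙-× (no _)  _  = refl
𝟙-× (yes _) Q? = sym (+-identityʳ (𝟙 Q?))

𝟙-*-mono : ∀ {m k} (P? : Dec P) → (P → m ≤ k) → 𝟙 P? * m ≤ 𝟙 P? * k
𝟙-*-mono (yes p) m≤k = *-monoʳ-≤ 1 (m≤k p)
𝟙-*-mono (no _)  _   = z≤n

𝟙-disjoint : (P? : Dec P) (Q? : Dec Q) (R? : Dec R) →
             (P → ¬ Q) → (P → R) → (Q → R) → 𝟙 P? + 𝟙 Q? ≤ 𝟙 R?
𝟙-disjoint (yes p) (yes q) _  p⇒¬q _   _   = contradiction q (p⇒¬q p)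
𝟙-disjoint (yes p) (no _)  R? _    p⇒r _   = 𝟙-mono (yes p) R? p⇒r
𝟙-disjoint (no _)  Q?      R? _    _   q⇒r = 𝟙-mono Q? R? q⇒r

count : {P : Pred (Fin n) 0ℓ} → Decidable P → ℕ
count {n} P? = ∑[ i < n ] 𝟙 (P? i)

count-empty : {P : Pred (Fin n) 0ℓ} (P? : Decidable P) → (∀ i → ¬ P i) → count P? ≡ 0
count-empty {zero}  P? ¬P = refl
count-empty {suc n} P? ¬P with P? zero
... | yes p = contradiction p (¬P zero)
... | no _  = count-empty (P? ∘ suc) (¬P ∘ suc)

count-unique : {P : Pred (Fin n) 0ℓ} (P? : Decidable P) →
               (∀ {i j} → P i → P j → i ≡ j) → count P? ≤ 1
count-unique {zero}  P? unique = z≤n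
count-unique {suc n} P? unique with P? zero
... | yes p = ≤-reflexive (cong suc (count-empty (P? ∘ suc) λ i q → case unique p q of λ ()))
... | no _  = count-unique (P? ∘ suc) λ p q → case unique p q of λ { refl → refl }

-- If `Q` fails the count is zero, so the bound is asked for only under `Q`.
count-guarded : ∀ {k} {P : Pred (Fin n) 0ℓ} (Q? : Dec Q) (P? : Decidable P) →
                (Q → count P? ≤ k) → count (λ i → Q? ×-dec P? i) ≤ k
count-guarded     (yes q) P? bound = bound q
count-guarded {n} (no _)  P? _     =
  ≤-trans (≤-reflexive (trans (∑-const n 0) (*-zeroʳ n))) z≤n

-- Choosing a vertex that avoids given vertices and colours

InjectiveOn : Pred (Fin n) 0ℓ → (Fin n → ℕ) → Set
InjectiveOn P f = ∀ {i j} → P i → P j → f i ≡ f j → i ≡ j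

-- A pair `(f , a)` forbids the value `a` for `f`. With `toℕ` as `f` it excludes a vertex, with
-- `col C v` a colour at `v`, so both kinds of condition fit in one list.
Constraint : ℕ → Set
Constraint n = (Fin n → ℕ) × ℕ

Avoids : List (Constraint n) → Pred (Fin n) 0ℓ
Avoids bs i = All (λ (f , a) → f i ≢ a) bs

avoids? : (bs : List (Constraint n)) → Decidable (Avoids bs)
avoids? bs i = All.all? (λ (f , a) → ¬? (f i ≟ a)) bs

-- By injectivity on `P`, every constraint removes at most one element.
count-avoiding : {P : Pred (Fin n) 0ℓ} (P? : Decidable P) (bs : List (Constraint n)) →
                 All (InjectiveOn P ∘ proj₁) bs →
                 count P? ≤ length bs + count (λ i → P? i ×-dec avoids? bs i)
count-avoiding P? [] [] = ∑-mono λ i → 𝟙-mono (P? i) (P? i ×-dec avoids? [] i) λ p → p , []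
count-avoiding {n} {P} P? ((f , a) ∷ bs) (inj ∷ injs) = begin
  count P?
    ≤⟨ count-avoiding P? bs injs ⟩
  length bs + count (λ i → P? i ×-dec avoids? bs i)
    ≤⟨ +-monoʳ-≤ (length bs) (∑-mono λ i → 𝟙-cover (P? i ×-dec avoids? bs i) (hit? i) (miss? i) (split i)) ⟩
  length bs + ∑[ i < n ] (𝟙 (hit? i) + 𝟙 (miss? i))
    ≡⟨ cong (length bs +_) (∑-distrib-+ (𝟙 ∘ hit?) (𝟙 ∘ miss?)) ⟩
  length bs + (count hit? + count miss?)
    ≤⟨ +-monoʳ-≤ (length bs) (+-monoˡ-≤ _ (count-unique hit?
         λ (p , fi) (q , fj) → inj p q (trans fi (sym fj)))) ⟩
  length bs + suc (count miss?)
    ≡⟨ +-suc (length bs) _ ⟩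
  suc (length bs) + count miss? ∎
  where
  open ≤-Reasoning
  hit? : Decidable (λ i → P i × f i ≡ a)
  hit? i = P? i ×-dec f i ≟ a
  miss? : Decidable (λ i → P i × Avoids ((f , a) ∷ bs) i)
  miss? i = P? i ×-dec avoids? ((f , a) ∷ bs) i
  split : ∀ i → P i × Avoids bs i → (P i × f i ≡ a) ⊎ (P i × Avoids ((f , a) ∷ bs) i)
  split i (p , ok) with f i ≟ a
  ... | yes eq = inj₁ (p , eq)
  ... | no ne  = inj₂ (p , ne ∷ ok)

-- The greedy step for building 5-cycles: more candidates than constraints leave one candidate over.
choose : {P : Pred (Fin n) 0ℓ} (P? : Decidable P) (bs : List (Constraint n)) →
         All (InjectiveOn P ∘ proj₁) bs → length bs < count P? →
         ∃ λ i → P i × Avoids bs i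
choose P? bs injs many with any? (λ i → P? i ×-dec avoids? bs i)
... | yes found = found
... | no none   = contradiction many (≤⇒≯ (begin
  count P?
    ≤⟨ count-avoiding P? bs injs ⟩
  length bs + count (λ i → P? i ×-dec avoids? bs i)
    ≡⟨ cong (length bs +_) (count-empty (λ i → P? i ×-dec avoids? bs i) λ i q → none (i , q)) ⟩
  length bs + 0
    ≡⟨ +-identityʳ _ ⟩
  length bs ∎))
  where open ≤-Reasoning

-- Triangles counted by a triple sum

module _ {A : Set} {P : Pred A 0ℓ} (P? : Decidable P) where

  length-filter-map-tabulate : ∀ {B : Set} (h : B → A) (g : Fin n → B) →
    length (filter P? (map h (tabulate g))) ≡ ∑[ i < n ] 𝟙 (P? (h (g i)))
  length-filter-map-tabulate {zero}  h g = refl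
  length-filter-map-tabulate {suc n} h g with P? (h (g zero))
  ... | yes _ = cong suc (length-filter-map-tabulate h (g ∘ suc))
  ... | no _  = length-filter-map-tabulate h (g ∘ suc)

  length-filter-concatMap-tabulate : ∀ {B : Set} (h : B → List A) (g : Fin n → B) →
    length (filter P? (concatMap h (tabulate g))) ≡ ∑[ i < n ] length (filter P? (h (g i)))
  length-filter-concatMap-tabulate {zero}  h g = refl
  length-filter-concatMap-tabulate {suc n} h g = begin
    length (filter P? (h (g zero) ++ rest))
      ≡⟨ cong length (filter-++ P? (h (g zero)) rest) ⟩
    length (filter P? (h (g zero)) ++ filter P? rest)
      ≡⟨ length-++ (filter P? (h (g zero))) ⟩
    length (filter P? (h (g zero))) + length (filter P? rest)
      ≡⟨ cong (length (filter P? (h (g zero))) +_) (length-filter-concatMap-tabulate h (g ∘ suc)) ⟩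
    ∑[ i < suc n ] length (filter P? (h (g i))) ∎
    where
    open ≡-Reasoning
    rest = concatMap h (tabulate (g ∘ suc))

triangleCount-∑ : (G : Graph n) →
  triangleCount G ≡ ∑[ a < n ] ∑[ b < n ] ∑[ c < n ] 𝟙 (isTriangle? G (a , b , c))
triangleCount-∑ {n} G =
  trans (length-filter-concatMap-tabulate (isTriangle? G) from₁ id) (sum-cong-≗ λ a →
  trans (length-filter-concatMap-tabulate (isTriangle? G) (from₂ a) id) (sum-cong-≗ λ b →
  length-filter-map-tabulate (isTriangle? G) (λ c → a , b , c) id))
  where
  from₂ : Fin n → Fin n → List (Fin n × Fin n × Fin n)
  from₂ a b = map (λ c → a , b , c) (allFin n)
  from₁ : Fin n → List (Fin n × Fin n × Fin n)
  from₁ a = concatMap (from₂ a) (allFin n)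

-- Codegrees

module _ {n : ℕ} (G : Graph n) where

  private variable
    u v w x y : Fin n

  Adj-sym : Adj G u v → Adj G v u
  Adj-sym {u} {v} = subst T (symm G u v)

  Adj⇒≢ : Adj G u v → u ≢ v
  Adj⇒≢ {u} uu refl = subst T (irrefl G u) uu

  Common : Fin n → Fin n → Pred (Fin n) 0ℓ
  Common u v w = Adj G u w × Adj G v w

  common? : ∀ u v → Decidable (Common u v)
  common? u v w = T? (adj G u w) ×-dec T? (adj G v w)

  codegree : Fin n → Fin n → ℕ
  codegree u v = count (common? u v)

  -- The threshold 6 is the number of constraints on the last vertex of a 5-cycle: a pair that is
  -- not few has at least seven common neighbours, so one survives.
  Few : Fin n → Fin n → Set
  Few u v = codegree u v ≤ 6

  few? : ∀ u v → Dec (Few u v)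
  few? u v = codegree u v ≤? 6

  -- With `Few` inside the indicator the bound holds for every pair, since a pair of larger codegree
  -- contributes nothing.
  ∑-few : ∀ u v → ∑[ w < n ] 𝟙 (few? u v ×-dec common? u v w) ≤ 6
  ∑-few u v = count-guarded (few? u v) (common? u v) id

  TriangleEdge : Fin n → Fin n → Set
  TriangleEdge u v = Adj G u v × ∃ (Common u v)

  triangleEdge? : ∀ u v → Dec (TriangleEdge u v)
  triangleEdge? u v = T? (adj G u v) ×-dec any? (common? u v)

  triangleDegree : Fin n → ℕ
  triangleDegree v = ∑[ u < n ] 𝟙 (triangleEdge? u v)

  M : ℕ
  M = ∑[ x < n ] triangleDegree x

  M≤n² : M ≤ n * n
  M≤n² = ∑-bounded λ x → ≤-trans (∑-bounded λ u → 𝟙≤1 (triangleEdge? u x))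
                                 (≤-reflexive (*-identityʳ n))

  -- Consequences of having no rainbow C₅

  module _ (C : ProperEdgeColoring G) (noRainbow : ¬ RainbowC5 G C) where

    -- Properness in the form that `choose` asks for; decidable equality of vertices removes the
    -- double negation.
    col-injective : Adj G u v → Adj G u w → col C u v ≡ col C u w → v ≡ w
    col-injective {u} {v} {w} uv uw eq =
      decidable-stable (v ≟ᶠ w) λ v≢w → proper C u v w uv uw v≢w eq

    -- The conditions listed are those on the five non-consecutive pairs of vertices and the five
    -- non-consecutive pairs of edges; irreflexivity and properness supply the rest. The closing
    -- edge is read from `v₀`, as are the colours chosen at that vertex.
    ¬C5 : ∀ v₀ v₁ v₂ v₃ v₄ →
      Adj G v₀ v₁ → Adj G v₁ v₂ → Adj G v₂ v₃ → Adj G v₃ v₄ → Adj G v₀ v₄ →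
      v₀ ≢ v₂ → v₀ ≢ v₃ → v₁ ≢ v₃ → v₁ ≢ v₄ → v₂ ≢ v₄ →
      col C v₀ v₁ ≢ col C v₂ v₃ → col C v₀ v₁ ≢ col C v₃ v₄ →
      col C v₁ v₂ ≢ col C v₃ v₄ → col C v₁ v₂ ≢ col C v₀ v₄ →
      col C v₂ v₃ ≢ col C v₀ v₄ → ⊥
    ¬C5 v₀ v₁ v₂ v₃ v₄ e₀₁ e₁₂ e₂₃ e₃₄ e₀₄ d₀₂ d₀₃ d₁₃ d₁₄ d₂₄ ac ad bd be ce =
      noRainbow (record
        { v0 = v₀ ; v1 = v₁ ; v2 = v₂ ; v3 = v₃ ; v4 = v₄
        ; d01 = Adj⇒≢ e₀₁ ; d02 = d₀₂ ; d03 = d₀₃ ; d04 = Adj⇒≢ e₀₄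
        ; d12 = Adj⇒≢ e₁₂ ; d13 = d₁₃ ; d14 = d₁₄
        ; d23 = Adj⇒≢ e₂₃ ; d24 = d₂₄
        ; d34 = Adj⇒≢ e₃₄
        ; e01 = e₀₁ ; e12 = e₁₂ ; e23 = e₂₃ ; e34 = e₃₄ ; e40 = e₄₀
        ; c-a-b = consecutive e₀₁ e₁₂ d₀₂
        ; c-a-c = ac
        ; c-a-d = ad
        ; c-a-e = ≢-sym (consecutive e₄₀ e₀₁ (≢-sym d₁₄))
        ; c-b-c = consecutive e₁₂ e₂₃ d₁₃
        ; c-b-d = bd
        ; c-b-e = be ∘ flip₀₄
        ; c-c-d = consecutive e₂₃ e₃₄ d₂₄
        ; c-c-e = ce ∘ flip₀₄
        ; c-d-e = consecutive e₃₄ e₄₀ (≢-sym d₀₃)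
        })
      where
      e₄₀ = Adj-sym e₀₄
      flip₀₄ : ∀ {k} → k ≡ col C v₄ v₀ → k ≡ col C v₀ v₄
      flip₀₄ eq = trans eq (col-sym C v₄ v₀ e₄₀)
      consecutive : Adj G u v → Adj G v w → u ≢ w → col C u v ≢ col C v w
      consecutive {u} {v} {w} uv vw u≢w eq =
        proper C v u w (Adj-sym uv) vw u≢w (trans (sym (col-sym C u v uv)) eq)

    triangle-few : Adj G v x → Adj G v y → Adj G x y → Few v x ⊎ Few v y
    triangle-few {v} {x} {y} vx vy xy with few? v x | few? v y
    ... | yes few | _       = inj₁ few
    ... | no _    | yes few = inj₂ few
    ... | no many | no many′
      -- On the path `v w x y`, adjacency and properness settle all but `w ≢ y` and the colours of
      -- `vw` and `xy`.
      with w , (vw , xw) , w≢y ∷ vw≢xy ∷ [] ←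
        choose (common? v x)
          ((toℕ , toℕ y) ∷ (col C v , col C x y) ∷ [])
          ((λ _ _ → toℕ-injective) ∷ (λ p q → col-injective (proj₁ p) (proj₁ q)) ∷ [])
          (≤-trans (s≤s (s≤s (s≤s z≤n))) (≰⇒> many))
      -- The vertex `z` must avoid `x` and `w`, and each of the edges `yz` and `vz` must avoid the
      -- colours of the two edges not consecutive to it: six constraints.
      with z , (vz , yz) , z≢x ∷ z≢w ∷ yz≢vw ∷ yz≢wx ∷ vz≢wx ∷ vz≢xy ∷ [] ←
        choose (common? v y)
          ((toℕ , toℕ x) ∷ (toℕ , toℕ w) ∷ (col C y , col C v w) ∷ (col C y , col C w x) ∷
           (col C v , col C w x) ∷ (col C v , col C x y) ∷ [])
          ((λ _ _ → toℕ-injective) ∷ (λ _ _ → toℕ-injective) ∷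
           (λ p q → col-injective (proj₂ p) (proj₂ q)) ∷
           (λ p q → col-injective (proj₂ p) (proj₂ q)) ∷
           (λ p q → col-injective (proj₁ p) (proj₁ q)) ∷
           (λ p q → col-injective (proj₁ p) (proj₁ q)) ∷ [])
          (≰⇒> many′)
      with () ← ¬C5 v w x y z vw (Adj-sym xw) xy yz vz
        (Adj⇒≢ vx) (Adj⇒≢ vy) (w≢y ∘ cong toℕ) (≢-sym (z≢w ∘ cong toℕ)) (≢-sym (z≢x ∘ cong toℕ))
        vw≢xy (≢-sym yz≢vw) (≢-sym yz≢wx) (≢-sym vz≢wx) (≢-sym vz≢xy)

    far? : ∀ u x → Decidable (λ v → Adj G x v × ¬ Few u v)
    far? u x v = T? (adj G x v) ×-dec ¬? (few? u v)

    triangleEdge-far : ∀ {u x} → TriangleEdge u x → count (far? u x) ≤ 3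
    triangleEdge-far {u} {x} (ux , e , ue , xe) with count (far? u x) ≤? 3
    ... | yes few = few
    ... | no many
      -- The path `u e x v` imposes three constraints, whence the bound 3. Both `u` and `e` are
      -- themselves neighbours of `x`, so they have to be excluded.
      with v , (xv , far) , v≢u ∷ v≢e ∷ xv≢ue ∷ [] ←
        choose (far? u x)
          ((toℕ , toℕ u) ∷ (toℕ , toℕ e) ∷ (col C x , col C u e) ∷ [])
          ((λ _ _ → toℕ-injective) ∷ (λ _ _ → toℕ-injective) ∷
           (λ p q → col-injective (proj₁ p) (proj₁ q)) ∷ [])
          (≰⇒> many)
      -- The pair `u`, `v` is not few, so the path can be closed through `y` under six constraints
      -- of the same kind as in `triangle-few`.
      with y , (uy , vy) , y≢e ∷ y≢x ∷ vy≢ue ∷ vy≢ex ∷ uy≢ex ∷ uy≢xv ∷ [] ←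
        choose (common? u v)
          ((toℕ , toℕ e) ∷ (toℕ , toℕ x) ∷ (col C v , col C u e) ∷ (col C v , col C e x) ∷
           (col C u , col C e x) ∷ (col C u , col C x v) ∷ [])
          ((λ _ _ → toℕ-injective) ∷ (λ _ _ → toℕ-injective) ∷
           (λ p q → col-injective (proj₂ p) (proj₂ q)) ∷
           (λ p q → col-injective (proj₂ p) (proj₂ q)) ∷
           (λ p q → col-injective (proj₁ p) (proj₁ q)) ∷
           (λ p q → col-injective (proj₁ p) (proj₁ q)) ∷ [])
          (≰⇒> far)
      with () ← ¬C5 u e x v y ue (Adj-sym xe) xv vy uy
        (Adj⇒≢ ux) (≢-sym (v≢u ∘ cong toℕ)) (≢-sym (v≢e ∘ cong toℕ))
        (≢-sym (y≢e ∘ cong toℕ)) (≢-sym (y≢x ∘ cong toℕ))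
        (≢-sym xv≢ue) (≢-sym vy≢ue) (≢-sym vy≢ex) (≢-sym uy≢ex) (≢-sym uy≢xv)

    -- The square of the degree at `x` counts ordered pairs `(u , v)` of triangle-neighbours of `x`.
    -- Few pairs are counted by their common neighbours, the others by `triangleEdge-far` for each
    -- fixed `u` and `x`.
    ∑-triangleDegree² : ∑[ x < n ] (triangleDegree x * triangleDegree x) ≤ n * (n * 6) + M * 3
    ∑-triangleDegree² = begin
      ∑[ x < n ] (triangleDegree x * triangleDegree x)
        ≡⟨ sum-cong-≗ (λ x → ∑-*-∑ (λ u → E u x) (λ v → E v x)) ⟩
      ∑[ x < n ] ∑[ u < n ] ∑[ v < n ] (E u x * E v x)
        ≤⟨ ∑-mono (λ x → ∑-mono λ u → ∑-mono λ v → split u v x) ⟩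
      ∑[ x < n ] ∑[ u < n ] ∑[ v < n ] (near u v x + E u x * far u v x)
        ≡⟨ sum-cong-≗ (λ x → trans
             (sum-cong-≗ λ u → ∑-distrib-+ (λ v → near u v x) (λ v → E u x * far u v x))
             (∑-distrib-+ (λ u → ∑[ v < n ] near u v x) (λ u → ∑[ v < n ] (E u x * far u v x)))) ⟩
      ∑[ x < n ] ((∑[ u < n ] ∑[ v < n ] near u v x) + (∑[ u < n ] ∑[ v < n ] (E u x * far u v x)))
        ≡⟨ ∑-distrib-+ (λ x → ∑[ u < n ] ∑[ v < n ] near u v x)
                       (λ x → ∑[ u < n ] ∑[ v < n ] (E u x * far u v x)) ⟩
      (∑[ x < n ] ∑[ u < n ] ∑[ v < n ] near u v x) +
      (∑[ x < n ] ∑[ u < n ] ∑[ v < n ] (E u x * far u v x))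
        ≤⟨ +-mono-≤ ∑-near ∑-far ⟩
      n * (n * 6) + M * 3 ∎
      where
      open ≤-Reasoning
      E : Fin n → Fin n → ℕ
      E u x = 𝟙 (triangleEdge? u x)
      near far : Fin n → Fin n → Fin n → ℕ
      near u v x = 𝟙 (few? u v ×-dec common? u v x)
      far  u v x = 𝟙 (far? u x v)

      -- In the second case the factor `E u x` is kept because `triangleEdge-far` applies only when
      -- `ux` lies in a triangle.
      split : ∀ u v x → E u x * E v x ≤ near u v x + E u x * far u v x
      split u v x = begin
        E u x * E v x
          ≡⟨ 𝟙-× (triangleEdge? u x) (triangleEdge? v x) ⟨
        𝟙 (triangleEdge? u x ×-dec triangleEdge? v x)
          ≤⟨ 𝟙-cover (triangleEdge? u x ×-dec triangleEdge? v x)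
               (few? u v ×-dec common? u v x) (triangleEdge? u x ×-dec far? u x v) cases ⟩
        near u v x + 𝟙 (triangleEdge? u x ×-dec far? u x v)
          ≡⟨ cong (near u v x +_) (𝟙-× (triangleEdge? u x) (far? u x v)) ⟩
        near u v x + E u x * far u v x ∎
        where
        cases : TriangleEdge u x × TriangleEdge v x →
                (Few u v × Common u v x) ⊎ (TriangleEdge u x × Adj G x v × ¬ Few u v)
        cases (ux , vx) with few? u v
        ... | yes few = inj₁ (few , proj₁ ux , proj₁ vx)
        ... | no many = inj₂ (ux , Adj-sym (proj₁ vx) , many)

      ∑-near : ∑[ x < n ] ∑[ u < n ] ∑[ v < n ] near u v x ≤ n * (n * 6)
      ∑-near = begin
        ∑[ x < n ] ∑[ u < n ] ∑[ v < n ] near u v x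
          -- The sum over `x` moves innermost, where it counts the common neighbours of a fixed few
          -- pair.
          ≡⟨ ∑-comm (λ x u → ∑[ v < n ] near u v x) ⟩
        ∑[ u < n ] ∑[ x < n ] ∑[ v < n ] near u v x
          ≡⟨ sum-cong-≗ (λ u → ∑-comm (λ x v → near u v x)) ⟩
        ∑[ u < n ] ∑[ v < n ] ∑[ x < n ] near u v x
          ≤⟨ ∑-bounded (λ u → ∑-bounded λ v → ∑-few u v) ⟩
        n * (n * 6) ∎

      ∑-far-vertex : ∀ u x → ∑[ v < n ] (E u x * far u v x) ≤ E u x * 3
      ∑-far-vertex u x = ≤-trans (≤-reflexive (sym (*-distribˡ-sum (E u x) λ v → far u v x)))
                                   (𝟙-*-mono (triangleEdge? u x) triangleEdge-far)

      ∑-far : ∑[ x < n ] ∑[ u < n ] ∑[ v < n ] (E u x * far u v x) ≤ M * 3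
      ∑-far = begin
        ∑[ x < n ] ∑[ u < n ] ∑[ v < n ] (E u x * far u v x)
          ≤⟨ ∑-mono (λ x → ∑-mono λ u → ∑-far-vertex u x) ⟩
        ∑[ x < n ] ∑[ u < n ] (E u x * 3)
          ≡⟨ sum-cong-≗ (λ x → sym (*-distribʳ-sum 3 λ u → E u x)) ⟩
        ∑[ x < n ] (triangleDegree x * 3)
          ≡⟨ *-distribʳ-sum 3 triangleDegree ⟨
        M * 3 ∎

    M²≤9n³ : M * M ≤ 9 * n ^ 3
    M²≤9n³ = begin
      M * M
        ≤⟨ cauchy-schwarz triangleDegree ⟩
      n * ∑[ x < n ] (triangleDegree x * triangleDegree x)
        ≤⟨ *-monoʳ-≤ n ∑-triangleDegree² ⟩
      n * (n * (n * 6) + M * 3)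
        -- The trivial bound `M≤n²` absorbs the linear term into the quadratic one.
        ≤⟨ *-monoʳ-≤ n (+-monoʳ-≤ (n * (n * 6)) (*-monoˡ-≤ 3 M≤n²)) ⟩
      n * (n * (n * 6) + n * n * 3)
        ≡⟨ collect n ⟩
      9 * n ^ 3 ∎
      where
      open ≤-Reasoning
      collect : ∀ n → n * (n * (n * 6) + n * n * 3) ≡ 9 * (n * (n * (n * 1)))
      collect = solve-∀

    -- A triangle a < b < c is charged to the ordered pair (b , a) or (a , c), so
    -- that an ordered pair is charged only in one of the two ways.
    triangleCount≤6M : triangleCount G ≤ M * 6
    triangleCount≤6M = begin
      triangleCount G
        ≡⟨ triangleCount-∑ G ⟩
      ∑[ a < n ] ∑[ b < n ] ∑[ c < n ] 𝟙 (isTriangle? G (a , b , c))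
        ≤⟨ ∑-mono (λ a → ∑-mono λ b → ∑-mono λ c → split a b c) ⟩
      ∑[ a < n ] ∑[ b < n ] ∑[ c < n ]
        (down a b * near a b c + up a c * near a c b)
        ≡⟨ sum-cong-≗ (λ a → trans
             (sum-cong-≗ λ b → ∑-distrib-+ (λ c → down a b * near a b c) (λ c → up a c * near a c b))
             (∑-distrib-+ (λ b → ∑[ c < n ] (down a b * near a b c))
                          (λ b → ∑[ c < n ] (up a c * near a c b)))) ⟩
      ∑[ a < n ] ((∑[ b < n ] ∑[ c < n ] (down a b * near a b c)) +
                  (∑[ b < n ] ∑[ c < n ] (up a c * near a c b)))
        -- A triangle charged to `(a , c)` has `b` as its third vertex, so the sum over `b` must be
        -- innermost.
        ≡⟨ sum-cong-≗ (λ a → cong ((∑[ b < n ] ∑[ c < n ] (down a b * near a b c)) +_)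
             (∑-comm λ b c → up a c * near a c b)) ⟩
      ∑[ a < n ] ((∑[ b < n ] ∑[ c < n ] (down a b * near a b c)) +
                  (∑[ c < n ] ∑[ b < n ] (up a c * near a c b)))
        ≤⟨ ∑-mono (λ a → +-mono-≤ (∑-mono λ b → ∑-near (down a b) a b)
                                  (∑-mono λ c → ∑-near (up a c) a c)) ⟩
      ∑[ a < n ] ((∑[ b < n ] (down a b * 6)) + (∑[ c < n ] (up a c * 6)))
        ≡⟨ ∑-distrib-+ (λ a → ∑[ b < n ] (down a b * 6)) (λ a → ∑[ c < n ] (up a c * 6)) ⟩
      (∑[ a < n ] ∑[ b < n ] (down a b * 6)) + (∑[ a < n ] ∑[ c < n ] (up a c * 6))
        -- Exchanging the roles of the indices puts both kinds of charge to the pair `(b , a)` in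
        -- the same term.
        ≡⟨ cong ((∑[ a < n ] ∑[ b < n ] (down a b * 6)) +_) (∑-comm λ a c → up a c * 6) ⟩
      (∑[ a < n ] ∑[ b < n ] (down a b * 6)) + (∑[ a < n ] ∑[ b < n ] (up b a * 6))
        ≡⟨ ∑-distrib-+ (λ a → ∑[ b < n ] (down a b * 6)) (λ a → ∑[ b < n ] (up b a * 6)) ⟨
      ∑[ a < n ] ((∑[ b < n ] (down a b * 6)) + (∑[ b < n ] (up b a * 6)))
        ≡⟨ sum-cong-≗ (λ a → ∑-distrib-+ (λ b → down a b * 6) (λ b → up b a * 6)) ⟨
      ∑[ a < n ] ∑[ b < n ] (down a b * 6 + up b a * 6)
        ≤⟨ ∑-mono (λ a → ∑-mono λ b → merge a b) ⟩
      ∑[ a < n ] ∑[ b < n ] (𝟙 (triangleEdge? b a) * 6)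
        ≡⟨ sum-cong-≗ (λ a → sym (*-distribʳ-sum 6 λ b → 𝟙 (triangleEdge? b a))) ⟩
      ∑[ a < n ] (triangleDegree a * 6)
        ≡⟨ *-distribʳ-sum 6 triangleDegree ⟨
      M * 6 ∎
      where
      open ≤-Reasoning
      near : Fin n → Fin n → Fin n → ℕ
      near a b c = 𝟙 (few? a b ×-dec common? a b c)
      down? : ∀ a b → Dec (toℕ a < toℕ b × TriangleEdge b a)
      down? a b = toℕ a <? toℕ b ×-dec triangleEdge? b a
      up? : ∀ a c → Dec (toℕ a < toℕ c × TriangleEdge a c)
      up? a c = toℕ a <? toℕ c ×-dec triangleEdge? a c
      down up : Fin n → Fin n → ℕ
      down a b = 𝟙 (down? a b)
      up a c = 𝟙 (up? a c)

      split : ∀ a b c → 𝟙 (isTriangle? G (a , b , c)) ≤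
                        down a b * near a b c + up a c * near a c b
      split a b c = begin
        𝟙 (isTriangle? G (a , b , c))
          ≤⟨ 𝟙-cover (isTriangle? G (a , b , c))
               (down? a b ×-dec few? a b ×-dec common? a b c)
               (up? a c ×-dec few? a c ×-dec common? a c b) cases ⟩
        𝟙 (down? a b ×-dec few? a b ×-dec common? a b c) +
        𝟙 (up? a c ×-dec few? a c ×-dec common? a c b)
          ≡⟨ cong₂ _+_ (𝟙-× (down? a b) (few? a b ×-dec common? a b c))
                       (𝟙-× (up? a c) (few? a c ×-dec common? a c b)) ⟩
        down a b * near a b c + up a c * near a c b ∎
        where
        cases : IsTriangle G (a , b , c) →
                ((toℕ a < toℕ b × TriangleEdge b a) × Few a b × Common a b c) ⊎
                ((toℕ a < toℕ c × TriangleEdge a c) × Few a c × Common a c b)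
        -- The dichotomy is applied at the least vertex `a`, so the few pair is `a`, `b` or `a`,
        -- `c`.
        cases (a<b , b<c , ab , bc , ac) with triangle-few ab ac bc
        ... | inj₁ few = inj₁ ((a<b , Adj-sym ab , c , bc , ac) , few , ac , bc)
        ... | inj₂ few = inj₂ ((<-trans a<b b<c , ac , b , ab , Adj-sym bc) , few , ab , Adj-sym bc)

      ∑-near : ∀ k u v → ∑[ w < n ] (k * near u v w) ≤ k * 6
      ∑-near k u v = ≤-trans (≤-reflexive (sym (*-distribˡ-sum k (near u v)))) (*-monoʳ-≤ k (∑-few u v))

      -- The two orders of `a` and `b` exclude each other, so each ordered pair pays 6 once.
      merge : ∀ a b → down a b * 6 + up b a * 6 ≤ 𝟙 (triangleEdge? b a) * 6
      merge a b = ≤-trans (≤-reflexive (sym (*-distribʳ-+ 6 (down a b) (up b a)))) (*-monoˡ-≤ 6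
        (𝟙-disjoint (down? a b) (up? b a) (triangleEdge? b a)
          (λ (a<b , _) (b<a , _) → <-asym a<b b<a) proj₂ proj₂))

-- Squaring both sides removes the fractional exponent: 1024 is the square of 32.
theorem2p1 : (n : ℕ) → 1 ≤ n → (G : Graph n) → (c : ProperEdgeColoring G) →
    ¬ RainbowC5 G c →
    triangleCount G ^ 2 ≤ 1024 * n ^ 3
theorem2p1 n _ G c noRainbow = begin
  t ^ 2
    ≤⟨ ^-monoˡ-≤ 2 (triangleCount≤6M G c noRainbow) ⟩
  (m * 6) ^ 2
    ≡⟨ square m ⟩
  36 * (m * m)
    ≤⟨ *-monoʳ-≤ 36 (M²≤9n³ G c noRainbow) ⟩
  36 * (9 * n ^ 3)
    ≡⟨ *-assoc 36 9 (n ^ 3) ⟨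
  324 * n ^ 3
    -- The argument yields the constant 324, the square of 18; the difference to 1024 is 700.
    ≤⟨ *-monoˡ-≤ (n ^ 3) (m≤m+n 324 700) ⟩
  1024 * n ^ 3 ∎
  where
  open ≤-Reasoning
  t = triangleCount G
  m = M G
  square : ∀ m → m * 6 * (m * 6 * 1) ≡ 36 * (m * m)
  square = solve-∀
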